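{- Let $G$ be a (not necessarily connected) graph of order $n\ge 2$ and let $\overline G$ be its complement. Then $3\le\eta(G)+\eta(\overline G)\le 2n-1$. Moreover: (i) $\eta(G)+\eta(\overline G)=3$ if and only if $\{G,\overline G\}=\{K_2,\overline K_2\}$; (ii) $\eta(G)+\eta(\overline G)=2n-1$ if and only if $\{G,\overline G\}=\{K_n,\overline K_n\}$. (Equalities of graphs are up to isomorphism.)
   Context: Graphs are finite, simple and undirected, and not necessarily connected; a graph is nontrivial if it has order $n\ge 2$. $K_n$ is the complete graph and $\overline K_n$ the edgeless graph on $n$ vertices. For a graph $G=(V,E)$, $d(u,v)$ is the usual distance, with value $\infty$ when $u,v$ are in different components. A set $D=\{x_1,\dots,x_k\}\subseteq V$ is dominating if every vertex of $V\setminus D$ has a neighbor in $D$; it is locating if the vectors $(d(v,x_1),\dots,d(v,x_k))$, $v\in V$, are pairwise distinct. A metric-locating-dominating set is a set that is both dominating and locating. The metric-location-domination number $\eta(G)$ is the minimum cardinality of a metric-locating-dominating set of $G$. -}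

module Defs where

open import Data.Empty using (⊥)
open import Data.Fin as Fin using (Fin; zero; suc)
open import Data.Fin.Properties using (_≟_; any?; all?; pigeonhole)
open import Data.Fin.Subset using (Subset; _∈_; _∉_; ∣_∣; ⊤)
open import Data.Fin.Subset.Properties using (_∈?_; anySubset?; ∈⊤)
open import Data.List.Base as List using (List; allFin; filter; map)
open import Data.List.Membership.Propositional using () renaming (_∈_ to _∈ˡ_)
open import Data.List.Membership.Propositional.Properties using (∈-filter⁺; ∈-allFin)
open import Data.List.Properties as List using (∷-injective)
open import Data.List.Relation.Unary.Any using (here; there)
import Data.Maybe.Properties as Maybe
open import Data.Nat.Base using (ℕ; zero; suc; _≤_; _<_; z≤n; s≤s)
open import Data.Nat.Induction using (<-rec)
open import Data.Nat.Properties as ℕ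
  using (≤-refl; ≮⇒≥; n≤0⇒n≡0; _<?_; <⇒≱; m≤n⇒m<n∨m≡n; m≤n⇒m≤1+n)
open import Data.Product.Base using (∃; _×_; _,_; proj₁; proj₂)
open import Data.Sum.Base using (_⊎_; inj₁; inj₂)
open import Function.Bundles using (_↔_; _⇔_; Inverse)
open import Level using (Level; 0ℓ)
open import Relation.Binary.Core using (Rel)
open import Relation.Binary.Definitions using (Decidable; Irreflexive; Symmetric)
open import Relation.Binary.PropositionalEquality
  using (_≡_; _≢_; refl; sym; trans; cong; subst)
open import Relation.Nullary.Construct.Add.Supremum using (_⁺; ⊤⁺; [_])
open import Relation.Nullary.Decidable using (Dec; yes; no; ¬?; _×-dec_; _→-dec_; map′)
open import Relation.Nullary.Negation using (¬_; contradiction)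
import Relation.Unary as Unary

private variable
  ℓ : Level
  m n : ℕ

------------------------------------------------------------------------
-- Minima of sets of natural numbers

IsMinimum : (ℕ → Set ℓ) → ℕ → Set ℓ
IsMinimum P k = P k × (∀ {j} → P j → k ≤ j)

search : {P : ℕ → Set ℓ} → Unary.Decidable P → ∀ b →
         ∃ (IsMinimum P) ⊎ (∀ {j} → P j → b ≤ j)
search P? zero = inj₂ (λ _ → z≤n)
search {P = P} P? (suc b) with search P? b
... | inj₁ found = inj₁ found
... | inj₂ b≤ with P? b
...   | yes Pb = inj₁ (b , Pb , b≤)
...   | no ¬Pb = inj₂ above
  where
  above : ∀ {j} → P j → b < j
  above Pj with m≤n⇒m<n∨m≡n (b≤ Pj)
  ... | inj₁ b<j  = b<j
  ... | inj₂ refl = contradiction Pj ¬Pb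

minimum : {P : ℕ → Set ℓ} → Unary.Decidable P → ∃ P → ∃ (IsMinimum P)
minimum P? (k , Pk) with search P? (suc k)
... | inj₁ found = found
... | inj₂ k<    = contradiction ≤-refl (<⇒≱ (k< Pk))

------------------------------------------------------------------------
-- Finite simple undirected graphs on the vertex set Fin n

record Graph (n : ℕ) : Set₁ where
  infix 4 _~_ _~?_
  field
    _~_      : Rel (Fin n) 0ℓ
    _~?_     : Decidable _~_
    ~-sym    : Symmetric _~_
    ~-irrefl : Irreflexive _≡_ _~_

K : ∀ n → Graph n
K n = record
  { _~_      = _≢_
  ; _~?_     = λ u v → ¬? (u ≟ v)
  ; ~-sym    = λ u≢v v≡u → u≢v (sym v≡u)
  ; ~-irrefl = λ u≡v u≢v → u≢v u≡v
  }

edgeless : ∀ n → Graph n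
edgeless n = record
  { _~_      = λ _ _ → ⊥
  ; _~?_     = λ _ _ → no λ ()
  ; ~-sym    = λ ()
  ; ~-irrefl = λ _ ()
  }

complement : Graph n → Graph n
complement G = record
  { _~_      = λ u v → u ≢ v × ¬ (u ~ v)
  ; _~?_     = λ u v → ¬? (u ≟ v) ×-dec ¬? (u ~? v)
  ; ~-sym    = λ (u≢v , u≁v) → (λ v≡u → u≢v (sym v≡u)) , (λ v~u → u≁v (~-sym v~u))
  ; ~-irrefl = λ u≡v (u≢v , _) → u≢v u≡v
  }
  where open Graph G

infix 4 _≅_
record _≅_ (G : Graph m) (H : Graph n) : Set where
  private
    module G = Graph G
    module H = Graph H
  field
    bijection : Fin m ↔ Fin n
  open Inverse bijection public using (to; from)
  field
    preserves : ∀ u v → (u G.~ v) ⇔ (to u H.~ to v)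

-- Equality of the unordered pairs {A , B} and {C , D} of graphs up to
-- isomorphism.
infix 4 ⟅_,_⟆≅⟅_,_⟆
⟅_,_⟆≅⟅_,_⟆ : Graph m → Graph m → Graph n → Graph n → Set
⟅ A , B ⟆≅⟅ C , D ⟆ = (A ≅ C × B ≅ D) ⊎ (A ≅ D × B ≅ C)

------------------------------------------------------------------------
-- Distance and metric-location-domination

module _ {n : ℕ} (G : Graph n) where
  open Graph G

  data Walk : Fin n → Fin n → ℕ → Set where
    []  : ∀ {u} → Walk u u 0
    _∷_ : ∀ {u v w k} → u ~ v → Walk v w k → Walk u w (suc k)

  -- A shortest walk is a path, so minimising over walks gives the usual
  -- distance.
  IsDistance : Fin n → Fin n → ℕ ⁺ → Set
  IsDistance u v [ k ] = IsMinimum (Walk u v) k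
  IsDistance u v ⊤⁺    = ∀ {k} → ¬ Walk u v k

  walk? : ∀ u v k → Dec (Walk u v k)
  walk? u v zero = map′ (λ { refl → [] }) (λ { [] → refl }) (u ≟ v)
  walk? u w (suc k) =
    map′ (λ (_ , u~v , p) → u~v ∷ p) (λ { (u~v ∷ p) → _ , u~v , p })
         (any? λ v → (u ~? v) ×-dec walk? v w k)

  private
    vertex : ∀ {u v k} → Walk u v k → Fin (suc k) → Fin n
    vertex {u} _ zero    = u
    vertex (_ ∷ p) (suc i) = vertex p i

    drop : ∀ {u v k} (p : Walk u v k) i → ∃ λ j → Walk (vertex p i) v j × j ≤ k
    drop p zero = _ , p , ≤-refl
    drop (_ ∷ p) (suc i) with drop p i
    ... | j , q , j≤k = j , q , m≤n⇒m≤1+n j≤k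

    cut : ∀ {u v k} (p : Walk u v k) i i′ → i Fin.< i′ → vertex p i ≡ vertex p i′ →
          ∃ λ j → Walk u v j × j < k
    cut {v = v} (_ ∷ p) zero (suc i′) _ eq with drop p i′
    ... | j , q , j≤k = j , subst (λ x → Walk x v j) (sym eq) q , s≤s j≤k
    cut (e ∷ p) (suc i) (suc i′) (s≤s i<i′) eq with cut p i i′ i<i′ eq
    ... | j , q , j<k = suc j , e ∷ q , s≤s j<k

    shorten : ∀ {u v k} → Walk u v k → n ≤ k → ∃ λ j → Walk u v j × j < k
    shorten p n≤k with pigeonhole (s≤s n≤k) (vertex p)
    ... | i , i′ , i<i′ , eq = cut p i i′ i<i′ eq

    short-walk : ∀ {u v} k → Walk u v k → ∃ λ j → Walk u v j × j < n
    short-walk {u} {v} = <-rec (λ k → Walk u v k → ∃ λ j → Walk u v j × j < n) step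
      where
      step : ∀ k → (∀ {j} → j < k → Walk u v j → ∃ λ i → Walk u v i × i < n) →
             Walk u v k → ∃ λ j → Walk u v j × j < n
      step k rec p with k <? n
      ... | yes k<n = k , p , k<n
      ... | no  k≮n with shorten p (≮⇒≥ k≮n)
      ...   | j , q , j<k = rec j<k q

  distance : ∀ u v → ∃ (IsDistance u v)
  distance u v with search (walk? u v) n
  ... | inj₁ (k , min) = [ k ] , min
  ... | inj₂ n≤ = ⊤⁺ , λ p → let j , q , j<n = short-walk _ p in <⇒≱ j<n (n≤ q)

  d : Fin n → Fin n → ℕ ⁺
  d u v = proj₁ (distance u v)

  d-isDistance : ∀ u v → IsDistance u v (d u v)
  d-isDistance u v = proj₂ (distance u v)

  Dominating : Subset n → Set
  Dominating D = ∀ v → v ∉ D → ∃ λ x → x ∈ D × v ~ x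

  members : Subset n → List (Fin n)
  members D = filter (_∈? D) (allFin n)

  code : Subset n → Fin n → List (ℕ ⁺)
  code D v = map (d v) (members D)

  Locating : Subset n → Set
  Locating D = ∀ u v → u ≢ v → code D u ≢ code D v

  MetricLocatingDominating : Subset n → Set
  MetricLocatingDominating D = Dominating D × Locating D

  mld? : Unary.Decidable MetricLocatingDominating
  mld? D =
    (all? λ v → ¬? (v ∈? D) →-dec any? λ x → (x ∈? D) ×-dec (v ~? x))
    ×-dec
    (all? λ u → all? λ v → ¬? (u ≟ v) →-dec
      ¬? (List.≡-dec (Maybe.≡-dec ℕ._≟_) (code D u) (code D v)))

  d-refl : ∀ u → d u u ≡ [ 0 ]
  d-refl u with d u u | d-isDistance u u
  ... | [ k ] | _ , k≤ = cong [_] (n≤0⇒n≡0 (k≤ []))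
  ... | ⊤⁺    | none   = contradiction [] none

  d≡0⇒≡ : ∀ u v → d u v ≡ [ 0 ] → u ≡ v
  d≡0⇒≡ u v eq with d u v | d-isDistance u v
  d≡0⇒≡ u .u refl | .([ 0 ]) | [] , _ = refl

  private
    map-≡⁻ : ∀ {A B : Set} {f g : A → B} {x} xs → x ∈ˡ xs → map f xs ≡ map g xs → f x ≡ g x
    map-≡⁻ (_ List.∷ xs) (here refl) eq = proj₁ (∷-injective eq)
    map-≡⁻ (_ List.∷ xs) (there x∈)  eq = map-≡⁻ xs x∈ (proj₂ (∷-injective eq))

  ⊤-mld : MetricLocatingDominating ⊤
  ⊤-mld = (λ _ v∉⊤ → contradiction ∈⊤ v∉⊤) , λ u v u≢v eq →
    u≢v (sym (d≡0⇒≡ v u (trans (sym (at-u u v eq)) (d-refl u))))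
    where
    at-u : ∀ u v → code ⊤ u ≡ code ⊤ v → d u u ≡ d v u
    at-u u v = map-≡⁻ (members ⊤) (∈-filter⁺ (_∈? ⊤) (∈-allFin u) ∈⊤)

  MLDCardinality : ℕ → Set
  MLDCardinality k = ∃ λ D → MetricLocatingDominating D × ∣ D ∣ ≡ k

  minimumMLD : ∃ (IsMinimum MLDCardinality)
  minimumMLD = minimum (λ k → anySubset? λ D → mld? D ×-dec (∣ D ∣ ℕ.≟ k))
                       (∣ ⊤ {n} ∣ , ⊤ , ⊤-mld , refl)

  η : ℕ
  η = proj₁ minimumMLD

  η-isMinimum : IsMinimum MLDCardinality η
  η-isMinimum = proj₂ minimumMLD

{-# OPTIONS --safe #-}

-- An edge u ~ v makes V ∖ {u} metric-locating-dominating, so η G < n unless G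
-- has no edge, in which case domination forces η G = n.  Two vertices outside a
-- metric-locating-dominating set D that are adjacent to all of D have the same
-- code; hence η = n − 1 for complete graphs, and D has at least two elements as
-- soon as n ≥ 3, because for |D| ≤ 1 domination makes every vertex outside D
-- adjacent to all of D.
module Submission where

open import Defs
open import Data.Fin.Base using (zero; suc)
open import Data.Fin.Permutation using (↔⇒≡)
open import Data.Fin.Properties using (_≟_; any?)
open import Data.Fin.Subset using (Subset; _∈_; _∉_; ∣_∣; ⊤; ∁; ⁅_⁆; _-_)
open import Data.Fin.Subset.Properties
  using (_∈?_; ∈⊤; ∣⊤∣≡n; ∣⊥∣≡0; ∣⁅x⁆∣≡1; nonempty?; Empty-unique; x∈⁅x⁆;
         p⊆q⇒∣p∣≤∣q∣; x∈∁p⇒x∉p; x∈p∧x≢y⇒x∈p-y;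
         x∈p⇒∣p-x∣<∣p∣; ∣∁p∣≡n∸∣p∣)
open import Data.List.Base using (List; map; allFin)
open import Data.List.Membership.Propositional using () renaming (_∈_ to _∈ˡ_)
open import Data.List.Membership.Propositional.Properties using (∈-filter⁺; ∈-allFin)
open import Data.List.Properties using (map-cong-local; ∷-injective)
open import Data.List.Relation.Unary.All as All using ()
open import Data.List.Relation.Unary.All.Properties using (all-filter)
open import Data.List.Relation.Unary.Any using (here; there)
open import Data.Nat.Base using (ℕ; zero; suc; _+_; _*_; _∸_; _≤_; _<_; z≤n; s≤s; s≤s⁻¹)
open import Data.Nat.Properties
  using (≤-trans; ≤-reflexive; ≤-antisym; <⇒≱; <⇒≤; <⇒≢; ≰⇒>;
         +-mono-≤; +-comm; +-suc; +-identityʳ; m≤n+m∸n; +-monoʳ-≤; module ≤-Reasoning)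
open import Data.Product.Base using (∃₂; _×_; _,_; proj₁; proj₂)
open import Data.Sum.Base using (_⊎_; inj₁; inj₂)
open import Function.Bundles using (_⇔_; mk⇔; Equivalence; Inverse)
open import Function.Construct.Identity using (↔-id)
open import Relation.Binary.PropositionalEquality
  using (_≡_; _≢_; refl; sym; trans; cong; subst)
open import Relation.Nullary.Construct.Add.Supremum using (⊤⁺; [_])
open import Relation.Nullary.Decidable using (Dec; yes; no; decidable-stable)
open import Relation.Nullary.Negation using (¬_; contradiction)

private variable
  m n : ℕ

-- Finite subsets with at most one member or at most one non-member.

map-≡⁻ : ∀ {A B : Set} {f g : A → B} {x} {xs : List A} →
         x ∈ˡ xs → map f xs ≡ map g xs → f x ≡ g x
map-≡⁻ (here refl) eq = proj₁ (∷-injective eq)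
map-≡⁻ (there x∈)  eq = map-≡⁻ x∈ (proj₂ (∷-injective eq))

subsingleton⇒∣p∣≤1 : (p : Subset n) → (∀ {x y} → x ∈ p → y ∈ p → x ≡ y) → ∣ p ∣ ≤ 1
subsingleton⇒∣p∣≤1 {n} p unique with nonempty? p
... | no empty = subst (λ q → ∣ q ∣ ≤ 1) (sym (Empty-unique empty))
                       (≤-trans (≤-reflexive (∣⊥∣≡0 n)) z≤n)
... | yes (x , x∈p) = ≤-trans
  (p⊆q⇒∣p∣≤∣q∣ (λ y∈p → subst (_∈ ⁅ x ⁆) (unique x∈p y∈p) (x∈⁅x⁆ x)))
  (≤-reflexive (∣⁅x⁆∣≡1 x))

∣p∣≤1⇒subsingleton : (p : Subset n) → ∣ p ∣ ≤ 1 → ∀ {x y} → x ∈ p → y ∈ p → x ≡ y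
-- For distinct `x` and `y`, removing `y` leaves `x` in `p`, and removing `x` then shrinks the set
-- again, so `p` has at least two elements.
∣p∣≤1⇒subsingleton p ∣p∣≤1 {x} {y} x∈p y∈p = decidable-stable (x ≟ y) λ x≢y →
  contradiction ∣p∣≤1 (<⇒≱ (≤-trans
    (s≤s (≤-trans (s≤s z≤n) (x∈p⇒∣p-x∣<∣p∣ (x∈p∧x≢y⇒x∈p-y x∈p x≢y))))
    (x∈p⇒∣p-x∣<∣p∣ y∈p)))

cosubsingleton⇒n≤1+∣p∣ : (p : Subset n) → (∀ {x y} → x ∉ p → y ∉ p → x ≡ y) →
                         n ≤ suc ∣ p ∣
cosubsingleton⇒n≤1+∣p∣ {n} p unique = begin
  n                      ≤⟨ m≤n+m∸n n ∣ p ∣ ⟩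
  ∣ p ∣ + (n ∸ ∣ p ∣)    ≡⟨ cong (∣ p ∣ +_) (sym (∣∁p∣≡n∸∣p∣ p)) ⟩
  ∣ p ∣ + ∣ ∁ p ∣        ≤⟨ +-monoʳ-≤ ∣ p ∣ (subsingleton⇒∣p∣≤1 (∁ p)
                              λ x∈ y∈ → unique (x∈∁p⇒x∉p x∈) (x∈∁p⇒x∉p y∈)) ⟩
  ∣ p ∣ + 1              ≡⟨ +-comm ∣ p ∣ 1 ⟩
  suc ∣ p ∣              ∎
  where open ≤-Reasoning

-- Codes, distances and bounds on `η` for a single graph.

module _ (G : Graph n) where
  open Graph G

  HasEdge Edgeless Complete : Set
  HasEdge  = ∃₂ λ u v → u ~ v
  Edgeless = ∀ u v → ¬ u ~ v
  Complete = ∀ u v → u ≢ v → u ~ v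

  hasEdge? : Dec HasEdge
  hasEdge? = any? λ u → any? λ v → u ~? v

  ~⇒≢ : ∀ {u v} → u ~ v → u ≢ v
  ~⇒≢ u~v u≡v = ~-irrefl u≡v u~v

  -- The edge is itself a walk of length 1, which excludes larger and infinite distances;
  -- irreflexivity excludes 0.
  ~⇒d≡1 : ∀ {u v} → u ~ v → d G u v ≡ [ 1 ]
  ~⇒d≡1 {u} {v} u~v with d G u v | d-isDistance G u v
  ... | [ 0 ]           | [] , _  = contradiction refl (~⇒≢ u~v)
  ... | [ 1 ]           | _       = refl
  ... | [ suc (suc _) ] | _ , k≤  = contradiction (k≤ (u~v ∷ [])) λ { (s≤s ()) }
  ... | ⊤⁺              | none    = contradiction (u~v ∷ []) none

  code≡⇒d≡ : ∀ {D u v x} → x ∈ D → code G D u ≡ code G D v → d G u x ≡ d G v x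
  code≡⇒d≡ {D} {x = x} x∈D = map-≡⁻ (∈-filter⁺ (_∈? D) (∈-allFin x) x∈D)

  d≡⇒code≡ : ∀ {D u v} → (∀ {x} → x ∈ D → d G u x ≡ d G v x) → code G D u ≡ code G D v
  d≡⇒code≡ {D} eq = map-cong-local (All.map eq (all-filter (_∈? D) (allFin n)))

  -- The coordinate of the code at `u` is 0 for `u` itself, and distance 0 means equality. Hence
  -- only two vertices that both lie outside `D` can share a code.
  code≡∧∈⇒≡ : ∀ {D u v} → u ∈ D → code G D u ≡ code G D v → u ≡ v
  code≡∧∈⇒≡ {u = u} {v} u∈D eq =
    sym (d≡0⇒≡ G v u (trans (sym (code≡⇒d≡ u∈D eq)) (d-refl G u)))

  η≤ : ∀ {D} → MetricLocatingDominating G D → η G ≤ ∣ D ∣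
  η≤ {D} mld = proj₂ (η-isMinimum G) (D , mld , refl)

  ≤η : ∀ {k} → (∀ D → MetricLocatingDominating G D → k ≤ ∣ D ∣) → k ≤ η G
  ≤η bound with D , mld , ∣D∣≡η ← proj₁ (η-isMinimum G) =
    subst (_ ≤_) ∣D∣≡η (bound D mld)

  η≤n : η G ≤ n
  η≤n = ≤-trans (η≤ (⊤-mld G)) (≤-reflexive (∣⊤∣≡n n))

  -- Only `u` is left out: `v` dominates it, and of two distinct vertices at least one belongs to
  -- the set, which separates them.
  V∖u-mld : ∀ {u v} → u ~ v → MetricLocatingDominating G (⊤ - u)
  V∖u-mld {u} {v} u~v = dominating , locating
    where
    ∈V∖u : ∀ {w} → w ≢ u → w ∈ ⊤ - u
    ∈V∖u = x∈p∧x≢y⇒x∈p-y ∈⊤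

    dominating : Dominating G (⊤ - u)
    dominating w w∉ with w ≟ u
    ... | yes refl = v , ∈V∖u (λ v≡u → ~⇒≢ u~v (sym v≡u)) , u~v
    ... | no  w≢u  = contradiction (∈V∖u w≢u) w∉

    locating : Locating G (⊤ - u)
    locating w w′ w≢w′ eq with w ≟ u
    ... | yes refl = w≢w′ (sym (code≡∧∈⇒≡ (∈V∖u λ w′≡u → w≢w′ (sym w′≡u)) (sym eq)))
    ... | no  w≢u  = w≢w′ (code≡∧∈⇒≡ (∈V∖u w≢u) eq)

  hasEdge⇒η<n : HasEdge → η G < n
  hasEdge⇒η<n (u , v , u~v) = ≤-trans (s≤s (η≤ (V∖u-mld u~v)))
    (≤-trans (x∈p⇒∣p-x∣<∣p∣ (∈⊤ {x = u})) (≤-reflexive (∣⊤∣≡n n)))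

  edgeless⇒η≡n : Edgeless → η G ≡ n
  edgeless⇒η≡n edgeless = ≤-antisym η≤n (≤η λ D (dominating , _) →
    ≤-trans (≤-reflexive (sym (∣⊤∣≡n n))) (p⊆q⇒∣p∣≤∣q∣ {p = ⊤} λ {v} _ →
      decidable-stable (v ∈? D) λ v∉D →
        let x , _ , v~x = dominating v v∉D in edgeless v x v~x))

  -- Every vertex outside `D` has the code with all entries 1, so locating permits at most one such
  -- vertex.
  fullyAdjacentOutside⇒n≤1+∣D∣ : ∀ {D} → MetricLocatingDominating G D →
    (∀ {v x} → v ∉ D → x ∈ D → v ~ x) → n ≤ suc ∣ D ∣
  fullyAdjacentOutside⇒n≤1+∣D∣ {D} (_ , locating) adjacent =
    cosubsingleton⇒n≤1+∣p∣ D λ {u} {v} u∉D v∉D →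
      decidable-stable (u ≟ v) λ u≢v → locating u v u≢v
        (d≡⇒code≡ λ x∈D → trans (~⇒d≡1 (adjacent u∉D x∈D))
                                (sym (~⇒d≡1 (adjacent v∉D x∈D))))

  complete⇒n≤1+∣D∣ : Complete → ∀ D → MetricLocatingDominating G D → n ≤ suc ∣ D ∣
  complete⇒n≤1+∣D∣ complete D mld = fullyAdjacentOutside⇒n≤1+∣D∣ mld
    λ v∉D x∈D → complete _ _ λ { refl → v∉D x∈D }

  ∣D∣≤1⇒n≤1+∣D∣ : ∀ {D} → MetricLocatingDominating G D → ∣ D ∣ ≤ 1 → n ≤ suc ∣ D ∣
  ∣D∣≤1⇒n≤1+∣D∣ {D} mld@(dominating , _) ∣D∣≤1 = fullyAdjacentOutside⇒n≤1+∣D∣ mld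
    λ {v} v∉D x∈D → let y , y∈D , v~y = dominating v v∉D in
      -- The neighbour `y` supplied by domination must be `x`, as `D` has at most one member.
      subst (v ~_) (∣p∣≤1⇒subsingleton D ∣D∣≤1 y∈D x∈D) v~y

  3≤n⇒2≤η : 3 ≤ n → 2 ≤ η G
  3≤n⇒2≤η 3≤n = ≤η λ D mld → ≰⇒> λ ∣D∣≤1 →
    <⇒≱ 3≤n (≤-trans (∣D∣≤1⇒n≤1+∣D∣ mld ∣D∣≤1) (s≤s ∣D∣≤1))

complete⇒1+η≡n : 2 ≤ n → (G : Graph n) → Complete G → suc (η G) ≡ n
complete⇒1+η≡n (s≤s (s≤s _)) G complete = ≤-antisym
  (hasEdge⇒η<n G (zero , suc zero , complete _ _ λ ()))
  (s≤s (≤η G λ D mld → s≤s⁻¹ (complete⇒n≤1+∣D∣ G complete D mld)))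

-- Complete and edgeless graphs under complement and isomorphism.

complete⇒complement-edgeless : (G : Graph n) → Complete G → Edgeless (complement G)
complete⇒complement-edgeless G complete u v (u≢v , u≁v) = u≁v (complete u v u≢v)

edgeless⇒complement-complete : (G : Graph n) → Edgeless G → Complete (complement G)
edgeless⇒complement-complete G edgeless u v u≢v = u≢v , edgeless u v

complement-edgeless⇒complete : (G : Graph n) → Edgeless (complement G) → Complete G
complement-edgeless⇒complete G edgeless u v u≢v =
  decidable-stable (Graph._~?_ G u v) λ u≁v → edgeless u v (u≢v , u≁v)

complete⇒≅K : (G : Graph n) → Complete G → G ≅ K n
complete⇒≅K G complete = record
  { bijection = ↔-id _
  ; preserves = λ u v → mk⇔ (~⇒≢ G) (complete u v)
  }

edgeless⇒≅edgeless : (G : Graph n) → Edgeless G → G ≅ edgeless n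
edgeless⇒≅edgeless G edgeless = record
  { bijection = ↔-id _
  ; preserves = λ u v → mk⇔ (edgeless u v) λ ()
  }

≅K⇒complete : {G : Graph n} → G ≅ K m → Complete G
≅K⇒complete iso u v u≢v = Equivalence.from (preserves u v)
  -- Adjacency in `K m` is inequality, so the claim reduces to injectivity of `to`, obtained from
  -- its left inverse `from`.
  λ eq → u≢v (trans (sym (Inverse.strictlyInverseʳ bijection u))
                    (trans (cong from eq) (Inverse.strictlyInverseʳ bijection v)))
  where open _≅_ iso

≅edgeless⇒edgeless : {G : Graph n} → G ≅ edgeless m → Edgeless G
≅edgeless⇒edgeless iso u v = Equivalence.to (_≅_.preserves iso u v)

-- For `n` at least 2, exactly the graphs that attain the upper bound.
Extremal : Graph n → Set
Extremal G = Complete G ⊎ Edgeless G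

extremal⇒≅ : (G : Graph n) → Extremal G → ⟅ G , complement G ⟆≅⟅ K n , edgeless n ⟆
extremal⇒≅ G (inj₁ complete) = inj₁
  ( complete⇒≅K G complete
  , edgeless⇒≅edgeless (complement G) (complete⇒complement-edgeless G complete))
extremal⇒≅ G (inj₂ edgeless) = inj₂
  ( edgeless⇒≅edgeless G edgeless
  , complete⇒≅K (complement G) (edgeless⇒complement-complete G edgeless))

≅⇒extremal : {G : Graph n} → ⟅ G , complement G ⟆≅⟅ K m , edgeless m ⟆ → Extremal G
≅⇒extremal (inj₁ (G≅K , _)) = inj₁ (≅K⇒complete G≅K)
≅⇒extremal (inj₂ (G≅E , _)) = inj₂ (≅edgeless⇒edgeless G≅E)

-- Recovers `n ≡ 2` from an isomorphism with the order-two pair in the case of sum 3.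
≅⇒order : {G : Graph n} → ⟅ G , complement G ⟆≅⟅ K m , edgeless m ⟆ → n ≡ m
≅⇒order (inj₁ (G≅K , _)) = ↔⇒≡ (_≅_.bijection G≅K)
≅⇒order (inj₂ (G≅E , _)) = ↔⇒≡ (_≅_.bijection G≅E)

-- Separates equality from strict inequality in the upper bound: an edge on each side makes both
-- values of `η` less than `n`.
extremal⊎edges : (G : Graph n) → Extremal G ⊎ (HasEdge G × HasEdge (complement G))
extremal⊎edges G with hasEdge? G | hasEdge? (complement G)
... | no none | _       = inj₁ (inj₂ λ u v u~v → none (u , v , u~v))
... | yes _   | no none = inj₁ (inj₁ (complement-edgeless⇒complete G
                            λ u v u~v → none (u , v , u~v)))
... | yes e   | yes e′  = inj₂ (e , e′)

order2-extremal : (G : Graph 2) → Extremal G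
order2-extremal G with Graph._~?_ G zero (suc zero)
... | yes 0~1 = inj₁ λ
  { zero       zero       u≢v → contradiction refl u≢v
  ; zero       (suc zero) _   → 0~1
  ; (suc zero) zero       _   → Graph.~-sym G 0~1
  ; (suc zero) (suc zero) u≢v → contradiction refl u≢v
  }
... | no 0≁1 = inj₂ λ
  { zero       zero       → Graph.~-irrefl G refl
  ; zero       (suc zero) → 0≁1
  ; (suc zero) zero       1~0 → 0≁1 (Graph.~-sym G 1~0)
  ; (suc zero) (suc zero) → Graph.~-irrefl G refl
  }

-- Bounds on the sum and the equality cases.

1+a≡n∧b≡n⇒a+b≡2n∸1 : ∀ {a b n} → suc a ≡ n → b ≡ n → a + b ≡ 2 * n ∸ 1
-- `2 * suc a ∸ 1` computes to `a + (suc a + 0)`.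
1+a≡n∧b≡n⇒a+b≡2n∸1 {a} refl refl = cong (a +_) (sym (+-identityʳ (suc a)))

a<n∧b<n⇒a+b<2n∸1 : ∀ {a b n} → a < n → b < n → a + b < 2 * n ∸ 1
a<n∧b<n⇒a+b<2n∸1 {a} {b} {suc n} (s≤s a≤n) (s≤s b≤n) =
  ≤-trans (s≤s (+-mono-≤ a≤n b≤n))
    (≤-reflexive (trans (sym (+-suc n n)) (cong (n +_) (sym (+-identityʳ (suc n))))))

extremal⇒sum≡2n∸1 : 2 ≤ n → (G : Graph n) → Extremal G →
                    η G + η (complement G) ≡ 2 * n ∸ 1
extremal⇒sum≡2n∸1 2≤n G (inj₁ complete) = 1+a≡n∧b≡n⇒a+b≡2n∸1
  (complete⇒1+η≡n 2≤n G complete)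
  (edgeless⇒η≡n (complement G) (complete⇒complement-edgeless G complete))
extremal⇒sum≡2n∸1 2≤n G (inj₂ edgeless) =
  trans (+-comm (η G) (η (complement G))) (1+a≡n∧b≡n⇒a+b≡2n∸1
    (complete⇒1+η≡n 2≤n (complement G) (edgeless⇒complement-complete G edgeless))
    (edgeless⇒η≡n G edgeless))

edges⇒sum<2n∸1 : (G : Graph n) → HasEdge G × HasEdge (complement G) →
                 η G + η (complement G) < 2 * n ∸ 1
edges⇒sum<2n∸1 G (e , e′) =
  a<n∧b<n⇒a+b<2n∸1 (hasEdge⇒η<n G e) (hasEdge⇒η<n (complement G) e′)

sum≤2n∸1 : 2 ≤ n → (G : Graph n) → η G + η (complement G) ≤ 2 * n ∸ 1
sum≤2n∸1 2≤n G with extremal⊎edges G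
... | inj₁ extremal = ≤-reflexive (extremal⇒sum≡2n∸1 2≤n G extremal)
... | inj₂ edges    = <⇒≤ (edges⇒sum<2n∸1 G edges)

sum≡2n∸1⇒extremal : (G : Graph n) → η G + η (complement G) ≡ 2 * n ∸ 1 → Extremal G
sum≡2n∸1⇒extremal G eq with extremal⊎edges G
... | inj₁ extremal = extremal
... | inj₂ edges    = contradiction eq (<⇒≢ (edges⇒sum<2n∸1 G edges))

-- At order two the upper bound `2 * n ∸ 1` is 3, and every graph attains it.
order2-sum≡3 : (G : Graph 2) → η G + η (complement G) ≡ 3
order2-sum≡3 G = extremal⇒sum≡2n∸1 (s≤s (s≤s z≤n)) G (order2-extremal G)

-- Confines the value 3 to order two.
3≤n⇒4≤sum : 3 ≤ n → (G : Graph n) → 4 ≤ η G + η (complement G)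
3≤n⇒4≤sum 3≤n G = +-mono-≤ (3≤n⇒2≤η G 3≤n) (3≤n⇒2≤η (complement G) 3≤n)

3≤sum : 2 ≤ n → (G : Graph n) → 3 ≤ η G + η (complement G)
3≤sum {suc (suc zero)}    _ G = ≤-reflexive (sym (order2-sum≡3 G))
3≤sum {suc (suc (suc n))} _ G = <⇒≤ (3≤n⇒4≤sum (s≤s (s≤s (s≤s z≤n))) G)
3≤sum {suc zero}          (s≤s ())

sum≡3⇒≅ : 2 ≤ n → (G : Graph n) → η G + η (complement G) ≡ 3 →
          ⟅ G , complement G ⟆≅⟅ K 2 , edgeless 2 ⟆
sum≡3⇒≅ {suc (suc zero)}    _ G _  = extremal⇒≅ G (order2-extremal G)
sum≡3⇒≅ {suc (suc (suc n))} _ G eq =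
  contradiction (sym eq) (<⇒≢ (3≤n⇒4≤sum (s≤s (s≤s (s≤s z≤n))) G))
sum≡3⇒≅ {suc zero}          (s≤s ())

≅⇒sum≡3 : (G : Graph n) → ⟅ G , complement G ⟆≅⟅ K 2 , edgeless 2 ⟆ →
          η G + η (complement G) ≡ 3
≅⇒sum≡3 G iso with refl ← ≅⇒order iso = order2-sum≡3 G

theorem3 : ∀ (n : ℕ) → 2 ≤ n → (G : Graph n) →
    (3 ≤ η G + η (complement G) × η G + η (complement G) ≤ 2 * n ∸ 1)
    × (η G + η (complement G) ≡ 3 ⇔ ⟅ G , complement G ⟆≅⟅ K 2 , edgeless 2 ⟆)
    × (η G + η (complement G) ≡ 2 * n ∸ 1 ⇔ ⟅ G , complement G ⟆≅⟅ K n , edgeless n ⟆)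
theorem3 n 2≤n G =
    (3≤sum 2≤n G , sum≤2n∸1 2≤n G)
  , mk⇔ (sum≡3⇒≅ 2≤n G) (≅⇒sum≡3 G)
  , mk⇔ (λ eq → extremal⇒≅ G (sum≡2n∸1⇒extremal G eq))
        (λ iso → extremal⇒sum≡2n∸1 2≤n G (≅⇒extremal iso))
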